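{- The shift graph $G_{9,2}$ does not have the AOP property.
   Context: The shift graph $G_{n,2}$ has as vertices all pairs $(a_1,a_2)$ of integers with $1\leq a_1<a_2\leq n$; two vertices $(a_1,a_2)$ and $(b_1,b_2)$ are adjacent iff $a_2=b_1$ or $b_2=a_1$. An orientation of a simple undirected graph $G$ assigns exactly one direction to each edge; it is acyclic if it has no directed cycle. A graph $G$ has the AOP (acyclic one path) property if it has an acyclic orientation such that there is at most one directed path between any two vertices, i.e. for all distinct vertices $u,v$ there is at most one directed path from $u$ to $v$. -}

module Defs where

open import Data.List.Base using (List; head; last)
open import Data.List.Relation.Unary.Linked using (Linked)
open import Data.List.Relation.Unary.Unique.Propositional using (Unique)
open import Data.Maybe.Base using (just)
open import Data.Nat.Base using (ℕ; _≤_; _<_)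
open import Data.Nat.Properties using (<-irrefl; _<?_)
open import Data.Product.Base using (_×_; ∃-syntax)
open import Data.Sum.Base using (_⊎_; inj₁; inj₂; swap)
open import Level using (0ℓ)
open import Relation.Binary.Core using (Rel)
open import Relation.Binary.Definitions using (Symmetric; Irreflexive)
open import Relation.Binary.PropositionalEquality.Core using (_≡_; _≢_; refl; sym)
open import Relation.Nullary.Decidable.Core using (recompute)
open import Relation.Nullary.Negation.Core using (¬_)

record SimpleGraph : Set₁ where
  field
    Vertex     : Set
    Adj        : Rel Vertex 0ℓ
    adj-sym    : Symmetric Adj
    adj-irrefl : Irreflexive _≡_ Adj

record IsOrientation (G : SimpleGraph) (Arc : Rel (SimpleGraph.Vertex G) 0ℓ) : Set where
  open SimpleGraph G
  field
    arc⇒adj     : ∀ {u v} → Arc u v → Adj u v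
    exactly-one : ∀ {u v} → Adj u v →
                  (Arc u v × ¬ Arc v u) ⊎ (¬ Arc u v × Arc v u)

-- A path is identified with its sequence of vertices, so that two paths are
-- equal exactly when these sequences are, whatever the proofs of the arcs.
record IsDirectedPath {V : Set} (Arc : Rel V 0ℓ) (u v : V) (xs : List V) : Set where
  field
    starts   : head xs ≡ just u
    ends     : last xs ≡ just v
    arcs     : Linked Arc xs
    distinct : Unique xs

-- A directed cycle is a directed path from u to v closed up by an arc from
-- v to u. For an orientation of a simple graph its length is at least three,
-- since there are neither loops nor pairs of opposite arcs.
Acyclic : {V : Set} → Rel V 0ℓ → Set
Acyclic Arc = ¬ (∃[ u ] ∃[ v ] ∃[ xs ] IsDirectedPath Arc u v xs × Arc v u)

AtMostOnePath : {V : Set} → Rel V 0ℓ → Set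
AtMostOnePath Arc = ∀ u v → u ≢ v → ∀ xs ys →
  IsDirectedPath Arc u v xs → IsDirectedPath Arc u v ys → xs ≡ ys

HasAOP : SimpleGraph → Set₁
HasAOP G = ∃[ Arc ] IsOrientation G Arc × Acyclic Arc × AtMostOnePath Arc

-- The bounds are irrelevant, so a vertex is determined by its two entries.
record ShiftVertex (n : ℕ) : Set where
  constructor mkVertex
  field
    a₁ a₂  : ℕ
    .1≤a₁  : 1 ≤ a₁
    .a₁<a₂ : a₁ < a₂
    .a₂≤n  : a₂ ≤ n

open ShiftVertex using (a₁; a₂)

ShiftAdj : ∀ n → Rel (ShiftVertex n) 0ℓ
ShiftAdj n a b = a₂ a ≡ a₁ b ⊎ a₂ b ≡ a₁ a

a₂≢a₁ : ∀ {n} (a : ShiftVertex n) → a₂ a ≢ a₁ a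
a₂≢a₁ (mkVertex x y _ x<y _) y≡x = <-irrefl (sym y≡x) (recompute (x <? y) x<y)

shiftGraph : ℕ → SimpleGraph
shiftGraph n = record
  { Vertex     = ShiftVertex n
  ; Adj        = ShiftAdj n
  ; adj-sym    = swap
  ; adj-irrefl = λ { {a} refl (inj₁ p) → a₂≢a₁ a p ; {a} refl (inj₂ p) → a₂≢a₁ a p }
  }

{-# OPTIONS --safe #-}

-- In an AOP orientation every 4-cycle alternates between sources and sinks.
-- The edges (i,j)—(j,k) with j fixed form a complete bipartite graph, so if
-- 3 ≤ j ≤ n − 2 they all point the same way: all forwards, from (i,j) to (j,k),
-- or all backwards. For n = 9 there are five such j, so three of them, say
-- j < k < l, agree; then (1,j),(j,k),(k,l),(l,9) and (1,j),(j,l),(l,9) are two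
-- directed paths with the same ends.
module Submission where

open import Defs
open import Data.Empty using (⊥)
open import Data.List.Base using (List; []; _∷_; length)
open import Data.List.Relation.Binary.Sublist.Propositional using (_⊆_; []; _∷_; _∷ʳ_)
open import Data.List.Relation.Binary.Sublist.Propositional.Properties using (All-resp-⊆)
open import Data.List.Relation.Unary.All as All using (All; []; _∷_)
open import Data.List.Relation.Unary.AllPairs as AllPairs using (AllPairs; []; _∷_)
open import Data.List.Relation.Unary.Linked using ([-]; _∷_)
open import Data.Nat.Base using (ℕ; suc; _+_; _≤_; _<_; z≤n; s≤s)
open import Data.Nat.Properties
  using (_≟_; _≤?_; _<?_; ≤-refl; ≤-trans; <-trans; <⇒≤; <⇒≢; +-mono-≤; +-suc)
open import Data.Product.Base using (_×_; _,_; ∃₂; proj₁; proj₂)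
open import Data.Sum.Base using (_⊎_; inj₁; inj₂)
open import Function.Base using (flip; _∘_)
open import Level using (0ℓ)
open import Relation.Binary.Core using (Rel)
open import Relation.Binary.PropositionalEquality
  using (_≡_; _≢_; refl; sym; trans; cong; subst)
open import Relation.Nullary.Decidable using (from-yes; yes; no; _×-dec_)
open import Relation.Nullary.Negation.Core using (¬_; contradiction)
open import Relation.Unary using (Pred; _∪_)

open ShiftVertex using (a₁; a₂)

module _ (G : SimpleGraph) where
  open SimpleGraph G

  -- The 4-cycle is u, v, u′, v′. Like `NoShortcut`, this is stated for any relation, so that
  -- centres whose edges all point backwards are treated by passing to `flip Arc`.
  Alternating : Rel Vertex 0ℓ → Set
  Alternating R = ∀ {u u′ v v′} → u ≢ u′ → v ≢ v′ →
    Adj u v → Adj u v′ → Adj u′ v → Adj u′ v′ →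
    R u v → R u v′ × R u′ v × R u′ v′

  NoShortcut : Rel Vertex 0ℓ → Set
  NoShortcut R = ∀ {x y z w t} → R x y → R y z → R z w → R x t → R t w → ⊥

  -- Reversal turns sources into sinks, so the two sides of the 4-cycle trade places.
  alternating-flip : ∀ R → Alternating R → Alternating (flip R)
  alternating-flip R alt u≢ v≢ uv uv′ u′v u′v′ r
    with alt v≢ u≢ (adj-sym uv) (adj-sym u′v) (adj-sym uv′) (adj-sym u′v′) r
  ... | vu′ , v′u , v′u′ = v′u , vu′ , v′u′

  noShortcut-flip : ∀ R → NoShortcut R → NoShortcut (flip R)
  noShortcut-flip R ns p q r s t = ns r q p t s

  module AOP {Arc : Rel Vertex 0ℓ} (orient : IsOrientation G Arc)
             (acyclic : Acyclic Arc) (unique : AtMostOnePath Arc) where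
    open IsOrientation orient

    orientation : ∀ {u v} → Adj u v → Arc u v ⊎ Arc v u
    orientation e with exactly-one e
    ... | inj₁ (p , _) = inj₁ p
    ... | inj₂ (_ , q) = inj₂ q

    arc-asym : ∀ {u v} → Arc u v → ¬ Arc v u
    arc-asym p q with exactly-one (arc⇒adj p)
    ... | inj₁ (_ , ¬q) = ¬q q
    ... | inj₂ (¬p , _) = ¬p p

    arc⇒≢ : ∀ {u v} → Arc u v → u ≢ v
    arc⇒≢ p u≡v = adj-irrefl u≡v (arc⇒adj p)

    arc²⇒≢ : ∀ {x y z} → Arc x y → Arc y z → x ≢ z
    arc²⇒≢ p q refl = arc-asym p q

    path₁ : ∀ {x y} → Arc x y → IsDirectedPath Arc x y (x ∷ y ∷ [])
    path₁ p = record
      { starts = refl ; ends = refl ; arcs = p ∷ [-]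
      ; distinct = (arc⇒≢ p ∷ []) ∷ [] ∷ [] }

    path₂ : ∀ {x y z} → Arc x y → Arc y z → IsDirectedPath Arc x z (x ∷ y ∷ z ∷ [])
    path₂ p q = record
      { starts = refl ; ends = refl ; arcs = p ∷ q ∷ [-]
      ; distinct = (arc⇒≢ p ∷ arc²⇒≢ p q ∷ []) ∷ (arc⇒≢ q ∷ []) ∷ [] ∷ [] }

    -- Coinciding ends would make the three arcs a directed triangle.
    arc³⇒≢ : ∀ {x y z w} → Arc x y → Arc y z → Arc z w → x ≢ w
    arc³⇒≢ p q r refl = acyclic (_ , _ , _ , path₂ p q , r)

    path₃ : ∀ {x y z w} → Arc x y → Arc y z → Arc z w →
            IsDirectedPath Arc x w (x ∷ y ∷ z ∷ w ∷ [])
    path₃ p q r = record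
      { starts = refl ; ends = refl ; arcs = p ∷ q ∷ r ∷ [-]
      ; distinct = (arc⇒≢ p ∷ arc²⇒≢ p q ∷ arc³⇒≢ p q r ∷ [])
                 ∷ (arc⇒≢ q ∷ arc²⇒≢ q r ∷ []) ∷ (arc⇒≢ r ∷ []) ∷ [] ∷ [] }

    -- The two paths have the same ends but different lengths.
    noShortcut : NoShortcut Arc
    noShortcut p q r s t
      with () ← unique _ _ (arc³⇒≢ p q r) _ _ (path₃ p q r) (path₂ s t)

    -- Whichever way the edges z - w and w - x of the 4-cycle point, there is a directed 4-cycle, a
    -- path of length three beside a single arc, or two paths of length two from x to z; uniqueness
    -- would force y = w in the last case.
    no-transit : ∀ {x y z w} → y ≢ w → Adj z w → Adj w x → Arc x y → ¬ Arc y z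
    no-transit y≢w zw wx p q with orientation zw | orientation wx
    ... | inj₁ z→w | inj₁ w→x = acyclic (_ , _ , _ , path₃ p q z→w , w→x)
    ... | inj₁ z→w | inj₂ x→w
        with () ← unique _ _ (arc⇒≢ x→w) _ _ (path₃ p q z→w) (path₁ x→w)
    ... | inj₂ w→z | inj₁ w→x
        with () ← unique _ _ (arc⇒≢ w→z) _ _ (path₃ w→x p q) (path₁ w→z)
    ... | inj₂ w→z | inj₂ x→w
        with refl ← unique _ _ (arc²⇒≢ p q) _ _ (path₂ p q) (path₂ x→w w→z)
        = y≢w refl

    -- Otherwise v′ → u → v would pass through u inside the 4-cycle.
    same-source : ∀ {u u′ v v′} → u ≢ u′ → Adj u v′ → Adj u′ v → Adj u′ v′ →
                  Arc u v → Arc u v′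
    same-source u≢u′ uv′ u′v u′v′ p with orientation uv′
    ... | inj₁ u→v′ = u→v′
    ... | inj₂ v′→u = contradiction p (no-transit u≢u′ (adj-sym u′v) u′v′ v′→u)

    same-target : ∀ {u u′ v v′} → v ≢ v′ → Adj u v′ → Adj u′ v → Adj u′ v′ →
                  Arc u v → Arc u′ v
    same-target v≢v′ uv′ u′v u′v′ p with orientation u′v
    ... | inj₁ u′→v = u′→v
    ... | inj₂ v→u′ = contradiction v→u′ (no-transit v≢v′ u′v′ (adj-sym uv′) p)

    alternating : Alternating Arc
    alternating u≢u′ v≢v′ uv uv′ u′v u′v′ p =
      same-source u≢u′ uv′ u′v u′v′ p , u′→v ,
      same-source (u≢u′ ∘ sym) u′v′ uv uv′ u′→v
      where u′→v = same-target v≢v′ uv′ u′v u′v′ p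

-- Since the bounds are irrelevant, instances for different centres meet in definitionally equal
-- vertices.
Uniform : ∀ n → Rel (ShiftVertex n) 0ℓ → Pred ℕ 0ℓ
Uniform n R j = ∀ i k .(1≤i : 1 ≤ i) .(i<j : i < j) .(j<k : j < k) .(k≤n : k ≤ n) →
  R (mkVertex i j 1≤i i<j (≤-trans (<⇒≤ j<k) k≤n))
    (mkVertex j k (≤-trans 1≤i (<⇒≤ i<j)) j<k k≤n)

uniform : ∀ {n j} {R : Rel (ShiftVertex n) 0ℓ} → Alternating (shiftGraph n) R →
  (3≤j : 3 ≤ j) (j+2≤n : 2 + j ≤ n) →
  R (mkVertex 1 j ≤-refl (<⇒≤ 3≤j) (<⇒≤ (<⇒≤ j+2≤n)))
    (mkVertex j n (<⇒≤ (<⇒≤ 3≤j)) (<⇒≤ j+2≤n) ≤-refl) →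
  Uniform n R j
uniform {n} {j} {R} alt 3≤j j+2≤n base = spread
  where
  square : ∀ i k .(1≤i : 1 ≤ i) .(i<j : i < j) .(j<k : j < k) .(k≤n : k ≤ n) →
    1 ≢ i → n ≢ k →
    let u  = mkVertex 1 j ≤-refl (<⇒≤ 3≤j) (<⇒≤ (<⇒≤ j+2≤n))
        u′ = mkVertex i j 1≤i i<j (<⇒≤ (<⇒≤ j+2≤n))
        v  = mkVertex j n (<⇒≤ (<⇒≤ 3≤j)) (<⇒≤ j+2≤n) ≤-refl
        v′ = mkVertex j k (<⇒≤ (<⇒≤ 3≤j)) j<k k≤n
    in R u v′ × R u′ v × R u′ v′
  square i k _ _ _ _ 1≢i n≢k =
    alt (1≢i ∘ cong a₁) (n≢k ∘ cong a₂) (inj₁ refl) (inj₁ refl) (inj₁ refl) (inj₁ refl) base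

  spread : Uniform n R j
  spread i k 1≤i i<j j<k k≤n with 1 ≟ i | n ≟ k
  ... | yes refl | yes refl = base
  -- This edge shares (1,j) with the base edge, so a 4-cycle through both needs a second left
  -- vertex: (2,j), available as 3 ≤ j.
  ... | yes refl | no n≢k   = proj₁ (square 2 k (s≤s z≤n) 3≤j j<k k≤n (λ ()) n≢k)
  ... | no 1≢i   | yes refl = proj₁ (proj₂
    -- Symmetrically, (j,j+1) is the second right vertex; it differs from (j,n) as j + 2 ≤ n.
    (square i (suc j) 1≤i i<j ≤-refl (<⇒≤ j+2≤n) 1≢i (<⇒≢ j+2≤n ∘ sym)))
  ... | no 1≢i   | no n≢k   = proj₂ (proj₂ (square i k 1≤i i<j j<k k≤n 1≢i n≢k))

no-three-uniform : ∀ {n j k l} (R : Rel (ShiftVertex n) 0ℓ) → NoShortcut (shiftGraph n) R →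
  1 < j → j < k → k < l → l < n →
  Uniform n R j → Uniform n R k → Uniform n R l → ⊥
no-three-uniform {n} {j} {k} {l} R ns 1<j j<k k<l l<n U V W = ns
  (U 1 k ≤-refl 1<j j<k (<⇒≤ (<-trans k<l l<n)))
  (V j l (<⇒≤ 1<j) j<k k<l (<⇒≤ l<n))
  (W k n (<⇒≤ (<-trans 1<j j<k)) k<l l<n ≤-refl)
  (U 1 l ≤-refl 1<j (<-trans j<k k<l) (<⇒≤ l<n))
  (W j n (<⇒≤ 1<j) (<-trans j<k k<l) l<n ≤-refl)

AllPairs-resp-⊆ : ∀ {A : Set} {S : Rel A 0ℓ} {xs ys : List A} →
  xs ⊆ ys → AllPairs S ys → AllPairs S xs
AllPairs-resp-⊆ []         []       = []
AllPairs-resp-⊆ (y ∷ʳ p)   (_ ∷ ss) = AllPairs-resp-⊆ p ss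
AllPairs-resp-⊆ (refl ∷ p) (s ∷ ss) = All-resp-⊆ p s ∷ AllPairs-resp-⊆ p ss

-- This is the pigeonhole principle in additive form: bounds on the two parts add up to a bound on
-- the whole list.
All-∪-split : ∀ {A : Set} {P Q : Pred A 0ℓ} {xs} → All (P ∪ Q) xs →
  ∃₂ λ ys zs → (ys ⊆ xs × All P ys) × (zs ⊆ xs × All Q zs) ×
               length ys + length zs ≡ length xs
All-∪-split [] = [] , [] , ([] , []) , ([] , []) , refl
All-∪-split (pq ∷ pqs) with All-∪-split pqs | pq
... | ys , zs , (σ , ps) , (τ , qs) , eq | inj₁ p =
  _ ∷ ys , zs , (refl ∷ σ , p ∷ ps) , (_ ∷ʳ τ , qs) , cong suc eq
... | ys , zs , (σ , ps) , (τ , qs) , eq | inj₂ q =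
  ys , _ ∷ zs , (_ ∷ʳ σ , ps) , (refl ∷ τ , q ∷ qs) ,
  trans (+-suc (length ys) (length zs)) (cong suc eq)

-- These are the j for which both sides of the bipartite graph at j have at least two vertices.
Central : ℕ → Pred ℕ 0ℓ
Central n j = 3 ≤ j × 2 + j ≤ n

-- A sublist of an increasing list is increasing, so a longer one would begin with three centres j <
-- k < l.
uniform-length≤2 : ∀ {n js ks} (R : Rel (ShiftVertex n) 0ℓ) → NoShortcut (shiftGraph n) R →
  AllPairs _<_ ks → All (Central n) ks → js ⊆ ks → All (Uniform n R) js → length js ≤ 2
uniform-length≤2 {js = []}         R ns <s cs σ us = z≤n
uniform-length≤2 {js = _ ∷ []}     R ns <s cs σ us = s≤s z≤n
uniform-length≤2 {js = _ ∷ _ ∷ []} R ns <s cs σ us = ≤-refl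
uniform-length≤2 {js = j ∷ k ∷ l ∷ _} R ns <s cs σ (U ∷ V ∷ W ∷ _)
  with AllPairs-resp-⊆ σ <s | All-resp-⊆ σ cs
... | (j<k ∷ _) ∷ (k<l ∷ _) ∷ _ | (3≤j , _) ∷ _ ∷ (_ , l+2≤n) ∷ _ =
  contradiction W (no-three-uniform R ns (<⇒≤ 3≤j) j<k k<l (<⇒≤ l+2≤n) U V)

theorem18 : ¬ HasAOP (shiftGraph 9)
theorem18 (Arc , orient , acyclic , unique) =
  contradiction five≤four (λ { (s≤s (s≤s (s≤s (s≤s ())))) })
  where
  open AOP (shiftGraph 9) orient acyclic unique

  centre : List ℕ
  centre = 3 ∷ 4 ∷ 5 ∷ 6 ∷ 7 ∷ []

  increasing : AllPairs _<_ centre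
  increasing = from-yes (AllPairs.allPairs? _<?_ centre)

  central : All (Central 9) centre
  central = from-yes (All.all? (λ j → (3 ≤? j) ×-dec (2 + j ≤? 9)) centre)

  uniform-either : ∀ {j} → Central 9 j → (Uniform 9 Arc ∪ Uniform 9 (flip Arc)) j
  uniform-either {j} (3≤j , j+2≤9)
    -- The direction of the single edge (1,j) - (j,9) decides that of all edges at j.
    with orientation
           {mkVertex 1 j ≤-refl (<⇒≤ 3≤j) (<⇒≤ (<⇒≤ j+2≤9))}
           {mkVertex j 9 (<⇒≤ (<⇒≤ 3≤j)) (<⇒≤ j+2≤9) ≤-refl} (inj₁ refl)
  ... | inj₁ p = inj₁ (uniform alternating 3≤j j+2≤9 p)
  ... | inj₂ p =
    inj₂ (uniform (alternating-flip (shiftGraph 9) Arc alternating) 3≤j j+2≤9 p)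

  five≤four : 5 ≤ 4
  five≤four with All-∪-split (All.map uniform-either central)
  ... | _ , _ , (σ , ps) , (τ , qs) , eq = subst (_≤ 4) eq (+-mono-≤
    (uniform-length≤2 Arc noShortcut increasing central σ ps)
    (uniform-length≤2 (flip Arc) (noShortcut-flip (shiftGraph 9) Arc noShortcut)
      increasing central τ qs))
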